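{- Let $k\geq 1$, $n\geq 0$ and $0\leq p\leq n$ be integers. Then the number $c_p(M_{n,k})$ of induced subgraphs of the Munarini graph $M_{n,k}$ isomorphic to the hypercube $Q_p$ is $$c_p(M_{n,k})=\sum_{d=p}^{n}\sum_{j=0}^{d}\binom{d}{p}\binom{d}{j}\binom{n-j}{d}(k-1)^{d-j}.$$
   Context: For integers $k\geq 1$, $n\geq 0$, a $k$-generalized Pell string of length $n$ is a word of length $n$ over the alphabet $\{0,1,\ldots,k\}$ in which every maximal run of the character $k$ has even length (equivalently, a concatenation of letters from $\{0,1,\ldots,k-1,kk\}$). Let $\mathcal{F}_{n,k}$ be the set of these strings (for $n=0$ it contains only the empty string). The Munarini graph $M_{n,k}$ is the simple graph with vertex set $\mathcal{F}_{n,k}$ in which two vertices are adjacent if one of them can be obtained from the other either by replacing one occurrence of $0$ with some $i\in\{1,\ldots,k-1\}$, or by replacing one substring $00$ (two consecutive positions) with $kk$ (both replacements may be read in either direction, and both strings must be in $\mathcal{F}_{n,k}$). $Q_p$ is the $p$-dimensional hypercube ($Q_0=K_1$). Conventions: $0^0=1$, and $\binom{a}{b}=0$ if $b>a\geq 0$. -}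

module Defs where

open import Data.Bool.Base using (Bool; T)
open import Data.Fin.Base using (Fin; zero; fromℕ)
open import Data.List.Base using (List; _++_; head; last; map; replicate; upTo)
open import Data.Maybe.Base using (just)
open import Data.Nat.Base using (ℕ; suc; _+_; _∸_; NonZero)
open import Data.Nat.Divisibility using (_∣_)
open import Data.Nat.ListAction using (sum)
open import Data.Product.Base using (Σ; ∃; _×_; _,_; proj₁)
open import Data.Sum.Base using (_⊎_; inj₁; inj₂; swap)
open import Data.Vec.Base using (Vec; _∷_; lookup; toList)
open import Function.Bundles using (Inverse; _↔_; _⇔_)
open import Level using (0ℓ)
open import Relation.Binary.Bundles using (Setoid)
import Relation.Binary.Construct.On as On
open import Relation.Binary.PropositionalEquality using (_≡_; _≢_; refl; sym; setoid; _→-setoid_)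
open import Relation.Nullary.Negation using (¬_)

record Graph : Set₁ where
  field
    Vertex     : Set
    Adj        : Vertex → Vertex → Set
    Adj-sym    : ∀ {x y} → Adj x y → Adj y x
    Adj-irrefl : ∀ {x} → ¬ Adj x x

open Graph public

record _≅_ (G H : Graph) : Set where
  field
    bijection : Vertex G ↔ Vertex H
    adjacency : ∀ x y → Adj G x y ⇔ Adj H (Inverse.to bijection x) (Inverse.to bijection y)

VertexSet : Graph → Set
VertexSet G = Vertex G → Bool

induced : (G : Graph) → VertexSet G → Graph
induced G S = record
  { Vertex     = Σ (Vertex G) (λ v → T (S v))
  ; Adj        = λ x y → Adj G (proj₁ x) (proj₁ y)
  ; Adj-sym    = Adj-sym G
  ; Adj-irrefl = Adj-irrefl G
  }

-- An induced subgraph is determined by its vertex set, so two elements are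
-- identified when the vertex sets agree pointwise; the isomorphism with H
-- plays no role in the equality.
InducedCopies : (H G : Graph) → Setoid 0ℓ 0ℓ
InducedCopies H G =
  On.setoid {B = Σ (VertexSet G) (λ S → induced G S ≅ H)} (Vertex G →-setoid Bool) proj₁

HasCardinality : Setoid 0ℓ 0ℓ → ℕ → Set
HasCardinality A N = Inverse A (setoid (Fin N))

Hypercube : ℕ → Graph
Hypercube p = record
  { Vertex     = Vec Bool p
  ; Adj        = λ x y → ∃ λ i → lookup x i ≢ lookup y i × (∀ j → j ≢ i → lookup x j ≡ lookup y j)
  ; Adj-sym    = λ (i , x≢y , x≡y) → i , (λ eq → x≢y (sym eq)) , λ j j≢i → sym (x≡y j j≢i)
  ; Adj-irrefl = λ (_ , x≢x , _) → x≢x refl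
  }

Word : ℕ → ℕ → Set
Word n k = Vec (Fin (suc k)) n

-- A factorisation u · kᵐ · v in which u does not end, and v does not begin,
-- with k exhibits kᵐ as a maximal run (possibly empty, which is harmless).
EvenRuns : ∀ {n k} → Word n k → Set
EvenRuns {n} {k} w =
  ∀ (u : List (Fin (suc k))) (m : ℕ) (v : List (Fin (suc k))) →
  toList w ≡ u ++ replicate m (fromℕ k) ++ v →
  last u ≢ just (fromℕ k) → head v ≢ just (fromℕ k) →
  2 ∣ m

-- The proof is irrelevant, so that _≡_ on Pell strings is equality of words.
record PellString (n k : ℕ) : Set where
  constructor pell
  field
    word      : Word n k
    .evenRuns : EvenRuns word

open PellString public

infix 4 _⟶_

data _⟶_ {k : ℕ} : ∀ {n} → Word n k → Word n k → Set where
  0⟶i   : ∀ {n} {w : Word n k} (i : Fin (suc k)) → i ≢ zero → i ≢ fromℕ k →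
          zero ∷ w ⟶ i ∷ w
  00⟶kk : ∀ {n} {w : Word n k} →
          zero ∷ zero ∷ w ⟶ fromℕ k ∷ fromℕ k ∷ w
  there : ∀ {n} {w w′ : Word n k} (a : Fin (suc k)) → w ⟶ w′ →
          a ∷ w ⟶ a ∷ w′

⟶⇒≢ : ∀ {n k} .{{_ : NonZero k}} {w w′ : Word n k} → w ⟶ w′ → w ≢ w′
⟶⇒≢             (0⟶i i i≢0 _) refl = i≢0 refl
⟶⇒≢ {k = suc _} 00⟶kk         ()
⟶⇒≢             (there a s)   refl = ⟶⇒≢ s refl

Munarini : (n k : ℕ) → .{{NonZero k}} → Graph
Munarini n k = record
  { Vertex     = PellString n k
  ; Adj        = λ x y → word x ⟶ word y ⊎ word y ⟶ word x
  ; Adj-sym    = swap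
  ; Adj-irrefl = λ { (inj₁ s) → ⟶⇒≢ s refl ; (inj₂ s) → ⟶⇒≢ s refl }
  }

-- Sum over the integers i with a ≤ i ≤ b.
sumFromTo : (a b : ℕ) → (ℕ → ℕ) → ℕ
sumFromTo a b f = sum (map (λ i → f (a + i)) (upTo (suc b ∸ a)))

syntax sumFromTo a b (λ i → e) = ∑[ i from a to b ] e

{-# OPTIONS --safe #-}

-- A Pell string is a row of tiles 0, i (0 < i < k) and kk, and two strings are adjacent when one
-- arises from the other by blanking one nonblank tile.  Recording a tile kk by its first cell only,
-- adjacent strings differ in exactly one cell, where one of them is blank.  In a square of such
-- edges opposite edges change the same cell, so an embedded cube Q_p is an interval [b , t] in
-- which t is obtained from b by filling p cells.  As nonblank tiles can be blanked independently,
-- copies of Q_p correspond to strings t with p distinguished nonblank tiles; d and j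
-- in the formula count the nonblank tiles and the tiles kk of t.
module Submission where

open import Defs
open import Data.Bool.Base using (Bool; true; false; not; T; if_then_else_)
open import Data.Bool.Properties using (not-involutive; not-¬; ¬-not; T-irrelevant) renaming (_≟_ to _≟ᵇ_)
open import Data.Fin.Base using (Fin; zero; suc; fromℕ; inject₁)
open import Data.Fin.Properties using (any?; 2↔Bool; *↔×; +↔⊎; injective⇒≤; fromℕ≢inject₁; inject₁-injective; suc-injective) renaming (_≟_ to _≟ᶠ_)
open import Data.Fin.Relation.Unary.Top using (view; ‵fromℕ; ‵inject₁)
open import Data.List.Base as List using (List; []; _∷_; last; applyUpTo)
import Data.List.Properties as List
open import Data.Maybe.Base using (just)
open import Data.Nat.Base using (ℕ; zero; suc; _+_; _*_; _∸_; _^_; _≤_; _<_; z≤n; s≤s; s≤s⁻¹; NonZero; ≢-nonZero⁻¹)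
open import Data.Nat.Combinatorics using (_C_; nCn≡1; nCk≡nC[n∸k]; k>n⇒nCk≡0; nCk+nC[k+1]≡[n+1]C[k+1])
open import Data.Nat.Divisibility using (_∣0; ∣m+n∣m⇒∣n; ∣m∣n⇒∣m+n; ∣-refl; >⇒∤)
open import Data.Nat.ListAction using (sum)
open import Data.Nat.Properties using (≤-refl; ≤-trans; ≤-antisym; ≮⇒≥; ≰⇒>; <⇒≤; <⇒≱; _≤?_; _<?_; m≤n⇒m≤1+n; m+n≤o⇒m≤o∸n; m≤n⇒m∸n≡0; 0∸n≡0; +-∸-assoc; +-comm; *-zeroʳ; ^-monoʳ-<)
open import Data.Nat.Solver using (module +-*-Solver)
open import Data.Product.Base using (Σ; ∃; ∃₂; _×_; _,_; proj₁; proj₂)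
open import Data.Product.Function.NonDependent.Propositional using (_×-↔_)
open import Data.Sum.Base using (_⊎_; inj₁; inj₂) renaming (map to map⊎)
open import Data.Sum.Function.Propositional using (_⊎-↔_)
open import Data.Vec.Base using (Vec; []; _∷_; lookup; tabulate; replicate; updateAt) renaming (map to mapᵛ)
open import Data.Vec.Properties as Vec using (∷-injective; lookup∘updateAt; lookup∘updateAt′; lookup∘tabulate; lookup-map; tabulate∘lookup; tabulate-cong; updateAt-commutes; updateAt-updateAt; updateAt-cong; updateAt-id)
open import Function.Base using (_∘_; id)
open import Function.Bundles using (_↔_; mk↔ₛ′; mk⇔; Inverse; Injection; Equivalence)
import Function.Construct.Composition as Composition
import Function.Construct.Symmetry as Symmetry
open import Function.Properties.Bijection using (Bijection⇒Inverse)
open import Function.Properties.Inverse using (↔-refl; ↔-sym; ↔-trans; ↔⇒↣)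
open import Relation.Binary.PropositionalEquality using (_≡_; _≢_; refl; sym; trans; cong; cong₂; subst; subst₂; setoid; module ≡-Reasoning)
open import Relation.Nullary using (Dec; yes; no; does; ¬_; contradiction; contradiction-irr)
open import Relation.Nullary.Decidable using (map′; isYes; toWitness; fromWitness; _⊎-dec_)

-- Cubes in products of stars

-- Cells rather than tiles serve as coordinates because blanking a pair leaves two blanks, so the
-- position of a tile in the row is not stable under adjacency, while the position of a cell is.
-- Each cell carries a star centred at `o`. The tilings are only part of the product of these stars,
-- since the cell after a `κ` can never be filled; `Cubes` therefore works with any set `V`
-- coordinatised injectively, and an interval means the members of `V` between two bounds. An
-- embedded cube need not respect the order: each of its coordinates may point up or down, and its
-- orientation is recovered from the cell that it changes. The endpoints of the resulting interval
-- determine a code whose dimension `p′` is a priori unrelated to `p`; counting vertices gives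
-- `p ≡ p′`. Since copies are identified by their vertex sets, a code must be recoverable from its
-- set alone, which the greatest and least elements make possible.

flip : ∀ {p} → Fin p → Vec Bool p → Vec Bool p
flip i x = updateAt x i not

flip-involutive : ∀ {p} (i : Fin p) x → flip i (flip i x) ≡ x
flip-involutive i x =
  trans (updateAt-updateAt i x) (trans (updateAt-cong i not-involutive x) (updateAt-id i x))

lookup-flip : ∀ {p} (i : Fin p) x → lookup (flip i x) i ≢ lookup x i
lookup-flip i x eq = not-¬ refl (trans (sym eq) (lookup∘updateAt i x))

flip-distinct : ∀ {p} {i j : Fin p} x → i ≢ j → flip i x ≢ flip j x
flip-distinct {i = i} {j} x i≢j eq =
  lookup-flip i x (trans (cong (λ y → lookup y i) eq) (lookup∘updateAt′ i j i≢j x))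

flip-flip-distinct : ∀ {p} {i j : Fin p} x → i ≢ j → x ≢ flip j (flip i x)
flip-flip-distinct {i = i} {j} x i≢j eq = lookup-flip i x
  (trans (sym (lookup∘updateAt′ i j i≢j (flip i x))) (cong (λ y → lookup y i) (sym eq)))

-- Walk from x to y, flipping one by one the coordinates in which they differ.
flip-invariant : ∀ {p} {A : Set} (f : Vec Bool p → A) (x y : Vec Bool p) →
  (∀ i → lookup x i ≢ lookup y i → ∀ z → f z ≡ f (flip i z)) → f x ≡ f y
flip-invariant f []      []      inv = refl
flip-invariant f (a ∷ x) (b ∷ y) inv =
  trans (flip-invariant (f ∘ (a ∷_)) x y λ i x≢y z → inv (suc i) x≢y (a ∷ z)) head-step
  where
  head-step : f (a ∷ y) ≡ f (b ∷ y)
  head-step with a ≟ᵇ b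
  ... | yes a≡b = cong (λ c → f (c ∷ y)) a≡b
  ... | no  a≢b =
    trans (inv zero a≢b (a ∷ y)) (cong (λ c → f (c ∷ y)) (sym (¬-not (a≢b ∘ sym))))

module Cubes {V A : Set} (o : A) (o? : ∀ a → Dec (a ≡ o)) {n : ℕ}
             (at : V → Fin n → A) (at-injective : ∀ {t u} → (∀ q → at t q ≡ at u q) → t ≡ u)
             where

  -- A cell carries a star and not a complete graph: two values other than `o` are never joined.
  -- This excludes triangles within a cell and makes squares rigid.
  Edge : Fin n → V → V → Set
  Edge q t u = ((at t q ≡ o × at u q ≢ o) ⊎ (at u q ≡ o × at t q ≢ o))
             × (∀ r → r ≢ q → at t r ≡ at u r)

  infix 4 _≼_
  _≼_ : V → V → Set
  t ≼ u = ∀ q → at t q ≡ o ⊎ at t q ≡ at u q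

  edge-≢ : ∀ {q t u} → Edge q t u → at t q ≢ at u q
  edge-≢ (inj₁ (t≡o , u≢o) , _) eq = u≢o (trans (sym eq) t≡o)
  edge-≢ (inj₂ (u≡o , t≢o) , _) eq = t≢o (trans eq u≡o)

  edge-unique : ∀ {q r t u} → Edge q t u → at t r ≢ at u r → r ≡ q
  edge-unique {q} {r} (_ , off) t≢u with r ≟ᶠ q
  ... | yes r≡q = r≡q
  ... | no  r≢q = contradiction (off r r≢q) t≢u

  edge-from-o : ∀ {q t u} → Edge q t u → at t q ≡ o → at u q ≢ o
  edge-from-o (inj₁ (_ , u≢o) , _) _   = u≢o
  edge-from-o (inj₂ (_ , t≢o) , _) t≡o = contradiction t≡o t≢o

  edge-to-o : ∀ {q t u} → Edge q t u → at t q ≢ o → at u q ≡ o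
  edge-to-o (inj₁ (t≡o , _) , _) t≢o = contradiction t≡o t≢o
  edge-to-o (inj₂ (u≡o , _) , _) _   = u≡o

  agree : ∀ {t u} q → at t q ≡ at u q → (∀ r → r ≢ q → at t r ≡ at u r) → t ≡ u
  agree {t} {u} q on off = at-injective pointwise
    where
    pointwise : ∀ r → at t r ≡ at u r
    pointwise r with r ≟ᶠ q
    ... | yes refl = on
    ... | no  r≢q  = off r r≢q

  -- Suppose both edges at `a` change `q`. If `a` is not `o` there, `b` and `c` both are, so they
  -- coincide. If `a` is `o` there, `b` and `c` are not: either `bd` undoes the change and `d` is
  -- `a`, or only `cd` changes `q` and makes it `o` where `b` still has another value, or neither
  -- edge changes `q` and `b`, `c` agree.
  square-directions-distinct : ∀ {q r s e a b c d} →
    Edge q a b → Edge r a c → Edge s b d → Edge e c d → a ≢ d → b ≢ c → q ≢ r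
  square-directions-distinct {q} {_} {s} {e} {a} {b} {c} {d} ab ac bd cd a≢d b≢c refl
    with o? (at a q)
  ... | no a≢o = b≢c (agree q (trans (edge-to-o ab a≢o) (sym (edge-to-o ac a≢o)))
                              (λ r r≢q → trans (sym (proj₂ ab r r≢q)) (proj₂ ac r r≢q)))
  ... | yes a≡o with s ≟ᶠ q
  ...   | yes refl = a≢d (agree q (trans a≡o (sym (edge-to-o bd (edge-from-o ab a≡o))))
                                  (λ r r≢q → trans (proj₂ ab r r≢q) (proj₂ bd r r≢q)))
  ...   | no s≢q with e ≟ᶠ q
  ...     | yes refl = edge-from-o ab a≡o (trans (proj₂ bd q (s≢q ∘ sym))
                                                 (edge-to-o cd (edge-from-o ac a≡o)))
  ...     | no e≢q = b≢c (agree q (trans (proj₂ bd q (s≢q ∘ sym)) (sym (proj₂ cd q (e≢q ∘ sym))))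
                                  (λ r r≢q → trans (sym (proj₂ ab r r≢q)) (proj₂ ac r r≢q)))

  -- If `q` differed from `e`, the path through `c` would leave cell `q` alone, as `q` also differs
  -- from `r`. The path through `b` would then have to undo its change of `q`, giving `a ≡ d`.
  square-opposite-edges : ∀ {q r s e a b c d} →
    Edge q a b → Edge r a c → Edge s b d → Edge e c d → a ≢ d → b ≢ c → q ≡ e
  square-opposite-edges {q} {r} {s} {e} {a} {b} {c} {d} ab ac bd cd a≢d b≢c with q ≟ᶠ e
  ... | yes q≡e = q≡e
  ... | no  q≢e = contradiction (agree q a≡d λ r′ r′≢q →
                    trans (proj₂ ab r′ r′≢q) (proj₂ bd r′ (r′≢q ∘ λ r′≡s → trans r′≡s (sym q≡s)))) a≢d
    where
    a≡d : at a q ≡ at d q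
    a≡d = trans (proj₂ ac q (square-directions-distinct ab ac bd cd a≢d b≢c)) (proj₂ cd q q≢e)
    q≡s : q ≡ s
    q≡s = edge-unique bd λ b≡d → edge-≢ ab (trans a≡d (sym b≡d))

  -- Embedded cubes are intervals

  module Embedding {p : ℕ} (φ : Vec Bool p → V) (φ-injective : ∀ {x y} → φ x ≡ φ y → x ≡ y)
                   (φ-edge : ∀ x i → ∃ λ q → Edge q (φ x) (φ (flip i x)))
                   where

    retarget : ∀ {q t x y} → x ≡ y → Edge q t (φ x) → Edge q t (φ y)
    retarget refl e = e

    -- For `i ≡ j` this is one edge traversed both ways; otherwise the two edges are opposite sides
    -- of the square in coordinates `i` and `j`.
    direction-flip : ∀ i j x → proj₁ (φ-edge x i) ≡ proj₁ (φ-edge (flip j x) i)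
    direction-flip i j x with i ≟ᶠ j
    ... | yes refl = edge-unique (retarget (flip-involutive i x) (proj₂ (φ-edge (flip i x) i)))
                                 (edge-≢ (proj₂ (φ-edge x i)) ∘ sym)
    ... | no i≢j = square-opposite-edges
      (proj₂ (φ-edge x i)) (proj₂ (φ-edge x j)) (proj₂ (φ-edge (flip i x) j))
      (retarget (updateAt-commutes i j i≢j x) (proj₂ (φ-edge (flip j x) i)))
      (flip-flip-distinct x i≢j ∘ φ-injective) (flip-distinct x i≢j ∘ φ-injective)

    origin : Vec Bool p
    origin = replicate p true

    direction : Fin p → Fin n
    direction i = proj₁ (φ-edge origin i)

    edge : ∀ x i → Edge (direction i) (φ x) (φ (flip i x))
    edge x i = subst (λ q → Edge q _ _)
      (flip-invariant (λ y → proj₁ (φ-edge y i)) x origin λ j _ → direction-flip i j)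
      (proj₂ (φ-edge x i))

    direction-injective : ∀ {i j} → direction i ≡ direction j → i ≡ j
    direction-injective {i} {j} eq with i ≟ᶠ j
    ... | yes i≡j = i≡j
    ... | no  i≢j = contradiction eq (square-directions-distinct
      (edge origin i) (edge origin j) (edge (flip i origin) j)
      (retarget (updateAt-commutes i j i≢j origin) (edge (flip j origin) i))
      (flip-flip-distinct origin i≢j ∘ φ-injective) (flip-distinct origin i≢j ∘ φ-injective))

    -- Walking from `x` to `y` flips only coordinates in which they differ, and by hypothesis none
    -- of these has direction `q`.
    at-local : ∀ q {x y} → (∀ i → q ≡ direction i → lookup x i ≡ lookup y i) →
               at (φ x) q ≡ at (φ y) q
    at-local q {x} {y} same = flip-invariant (λ z → at (φ z) q) x y
      λ i x≢y z → proj₂ (edge z i) q (x≢y ∘ same i)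

    at-direction : ∀ i {x y} → lookup x i ≡ lookup y i →
                   at (φ x) (direction i) ≡ at (φ y) (direction i)
    at-direction i {x} {y} eq = at-local (direction i)
      λ j i≡j → subst (λ h → lookup x h ≡ lookup y h) (direction-injective i≡j) eq

    -- Across an edge in coordinate `i` exactly one end has `o` in the cell `direction i`. The test
    -- is made at `origin`, but by `at-direction` its outcome depends on bit `i` alone, so the bits
    -- can be found separately and assembled into one vertex.
    raised : Fin p → Bool
    raised i = lookup (if does (o? (at (φ origin) (direction i))) then flip i origin else origin) i

    highest lowest : Vec Bool p
    highest = tabulate raised
    lowest  = mapᵛ not highest

    top bottom : V
    top    = φ highest
    bottom = φ lowest

    top-≢o : ∀ i → at top (direction i) ≢ o
    top-≢o i top≡o with o? (at (φ origin) (direction i)) | lookup∘tabulate raised i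
    ... | yes ≡o | eq = edge-from-o (edge origin i) ≡o (trans (sym (at-direction i eq)) top≡o)
    ... | no  ≢o | eq = ≢o (trans (sym (at-direction i eq)) top≡o)

    -- `lowest` is the complement of `highest`, so at `i` it agrees with `flip i highest`; that
    -- vertex is joined to `highest` by an edge that leaves a non-`o` value, hence arrives at `o`.
    bottom-≡o : ∀ i → at bottom (direction i) ≡ o
    bottom-≡o i = trans
      (at-direction i (trans (lookup-map i not highest) (sym (lookup∘updateAt i highest))))
      (edge-to-o (edge highest i) (top-≢o i))

    ≼-top : ∀ x → φ x ≼ top
    ≼-top x q with any? (λ i → q ≟ᶠ direction i)
    ... | no  q∉ = inj₂ (at-local q λ i q≡ → contradiction (i , q≡) q∉)
    ... | yes (i , refl) with lookup x i ≟ᵇ lookup highest i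
    ...   | yes x≡ = inj₂ (at-direction i x≡)
    ...   | no  x≢ = inj₁ (trans (at-direction i (trans (¬-not x≢) (sym (lookup-map i not highest))))
                                 (bottom-≡o i))

    bottom-≼ : ∀ x → bottom ≼ φ x
    bottom-≼ x q with any? (λ i → q ≟ᶠ direction i)
    ... | no  q∉         = inj₂ (at-local q λ i q≡ → contradiction (i , q≡) q∉)
    ... | yes (i , refl) = inj₁ (bottom-≡o i)

    interval⊆image : ∀ {t} → bottom ≼ t → t ≼ top → ∃ λ x → φ x ≡ t
    interval⊆image {t} bottom≼t t≼top = x , at-injective pointwise
      where
      -- In the cell `direction i` the only values between the bounds are `o`, taken at `lowest`,
      -- and the value taken at `highest`.
      coordinate : Fin p → Bool
      coordinate i = lookup (if does (o? (at t (direction i))) then lowest else highest) i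

      x : Vec Bool p
      x = tabulate coordinate

      pointwise : ∀ q → at (φ x) q ≡ at t q
      pointwise q with any? (λ i → q ≟ᶠ direction i)
      -- In a cell that is no direction `φ` is constant, so `bottom`, `top` and `φ x` agree there,
      -- and lying between the bounds determines the value of `t`.
      pointwise q | no q∉ with bottom≼t q | t≼top q
      ... | _        | inj₂ t≡top = trans (at-local q λ i q≡ → contradiction (i , q≡) q∉) (sym t≡top)
      ... | inj₂ b≡t | inj₁ _     = trans (at-local q λ i q≡ → contradiction (i , q≡) q∉) b≡t
      ... | inj₁ b≡o | inj₁ t≡o   =
        trans (at-local q λ i q≡ → contradiction (i , q≡) q∉) (trans b≡o (sym t≡o))
      pointwise q | yes (i , refl) with o? (at t q) | lookup∘tabulate coordinate i
      ... | yes t≡o | eq = trans (at-direction i eq) (trans (bottom-≡o i) (sym t≡o))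
      ... | no  t≢o | eq with t≼top q
      ...   | inj₁ t≡o   = contradiction t≡o t≢o
      ...   | inj₂ t≡top = trans (at-direction i eq) (sym t≡top)

  image-is-interval : ∀ {p} (φ : Vec Bool p → V) → (∀ {x y} → φ x ≡ φ y → x ≡ y) →
    (∀ x i → ∃ λ q → Edge q (φ x) (φ (flip i x))) →
    ∃₂ λ b t → b ≼ t × (∀ x → b ≼ φ x × φ x ≼ t) × (∀ u → b ≼ u → u ≼ t → ∃ λ x → φ x ≡ u)
  image-is-interval φ φ-injective φ-edge =
    bottom , top , ≼-top lowest , (λ x → bottom-≼ x , ≼-top x) , λ _ → interval⊆image
    where open Embedding φ φ-injective φ-edge

-- Tilings and their subcubes

data Symbol (m : ℕ) : Set where
  o : Symbol m
  ℓ : Fin m → Symbol m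
  κ : Symbol m

-- Here `m` is the number of letters strictly between `0` and `k`, so `k` is `suc m`.
data Tiling (m : ℕ) : ℕ → Set where
  ε      : Tiling m 0
  blank  : ∀ {n} → Tiling m n → Tiling m (suc n)
  letter : ∀ {n} → Fin m → Tiling m n → Tiling m (suc n)
  pair   : ∀ {n} → Tiling m n → Tiling m (suc (suc n))

-- The second cell of a pair reads o, so that any two adjacent tilings differ in a single cell.
at : ∀ {m n} → Tiling m n → Fin n → Symbol m
at (blank t)    zero          = o
at (blank t)    (suc q)       = at t q
at (letter i t) zero          = ℓ i
at (letter i t) (suc q)       = at t q
at (pair t)     zero          = κ
at (pair t)     (suc zero)    = o
at (pair t)     (suc (suc q)) = at t q

o? : ∀ {m} (s : Symbol m) → Dec (s ≡ o)
o? o     = yes refl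
o? (ℓ _) = no λ ()
o? κ     = no λ ()

at-injective : ∀ {m n} {t u : Tiling m n} → (∀ q → at t q ≡ at u q) → t ≡ u
at-injective {t = ε}          {ε}          eq = refl
at-injective {t = blank t}    {blank u}    eq = cong blank (at-injective (eq ∘ suc))
at-injective {t = blank t}    {letter j u} eq = contradiction (eq zero) λ ()
at-injective {t = blank t}    {pair u}     eq = contradiction (eq zero) λ ()
at-injective {t = letter i t} {blank u}    eq = contradiction (eq zero) λ ()
at-injective {t = letter i t} {letter j u} eq with refl ← eq zero =
  cong (letter i) (at-injective (eq ∘ suc))
at-injective {t = letter i t} {pair u}     eq = contradiction (eq zero) λ ()
at-injective {t = pair t}     {blank u}    eq = contradiction (eq zero) λ ()
at-injective {t = pair t}     {letter j u} eq = contradiction (eq zero) λ ()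
at-injective {t = pair t}     {pair u}     eq = cong pair (at-injective (λ q → eq (suc (suc q))))

open module TilingCubes {m n} = Cubes o o? (at {m} {n}) at-injective using (Edge; _≼_; image-is-interval)

infix 4 _↑_ _⊑_

data _↑_ {m : ℕ} : ∀ {n} → Tiling m n → Tiling m n → Set where
  raise-letter : ∀ {n} {t : Tiling m n} {i} → blank t ↑ letter i t
  raise-pair   : ∀ {n} {t : Tiling m n} → blank (blank t) ↑ pair t
  in-blank     : ∀ {n} {t u : Tiling m n} → t ↑ u → blank t ↑ blank u
  in-letter    : ∀ {n} {t u : Tiling m n} {i} → t ↑ u → letter i t ↑ letter i u
  in-pair      : ∀ {n} {t u : Tiling m n} → t ↑ u → pair t ↑ pair u

-- The inductive form of `≼`, in which two blanks under a pair are matched as a unit. Recursion on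
-- it tells which tiles of the upper tiling were blanked.
data _⊑_ {m : ℕ} : ∀ {n} → Tiling m n → Tiling m n → Set where
  ε            : ε ⊑ ε
  blank        : ∀ {n} {t u : Tiling m n} → t ⊑ u → blank t ⊑ blank u
  letter       : ∀ {n} {t u : Tiling m n} {i} → t ⊑ u → letter i t ⊑ letter i u
  pair         : ∀ {n} {t u : Tiling m n} → t ⊑ u → pair t ⊑ pair u
  blank-letter : ∀ {n} {t u : Tiling m n} {i} → t ⊑ u → blank t ⊑ letter i u
  blanks-pair  : ∀ {n} {t u : Tiling m n} → t ⊑ u → blank (blank t) ⊑ pair u

⊑-antisym : ∀ {m n} {t u : Tiling m n} → t ⊑ u → u ⊑ t → t ≡ u
⊑-antisym ε          ε          = refl
⊑-antisym (blank l)  (blank g)  = cong blank (⊑-antisym l g)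
⊑-antisym (letter l) (letter g) = cong (letter _) (⊑-antisym l g)
⊑-antisym (pair l)   (pair g)   = cong pair (⊑-antisym l g)

⊑⇒≼ : ∀ {m n} {t u : Tiling m n} → t ⊑ u → t ≼ u
⊑⇒≼ (blank l)        zero          = inj₁ refl
⊑⇒≼ (blank l)        (suc q)       = ⊑⇒≼ l q
⊑⇒≼ (letter l)       zero          = inj₂ refl
⊑⇒≼ (letter l)       (suc q)       = ⊑⇒≼ l q
⊑⇒≼ (pair l)         zero          = inj₂ refl
⊑⇒≼ (pair l)         (suc zero)    = inj₁ refl
⊑⇒≼ (pair l)         (suc (suc q)) = ⊑⇒≼ l q
⊑⇒≼ (blank-letter l) zero          = inj₁ refl
⊑⇒≼ (blank-letter l) (suc q)       = ⊑⇒≼ l q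
⊑⇒≼ (blanks-pair l)  zero          = inj₁ refl
⊑⇒≼ (blanks-pair l)  (suc zero)    = inj₁ refl
⊑⇒≼ (blanks-pair l)  (suc (suc q)) = ⊑⇒≼ l q

≼⇒⊑ : ∀ {m n} (t u : Tiling m n) → t ≼ u → t ⊑ u
≼⇒⊑ ε                      ε            l = ε
≼⇒⊑ (blank t)              (blank u)    l = blank (≼⇒⊑ t u (l ∘ suc))
≼⇒⊑ (blank t)              (letter i u) l = blank-letter (≼⇒⊑ t u (l ∘ suc))
≼⇒⊑ (blank (blank t))      (pair u)     l = blanks-pair (≼⇒⊑ t u (λ q → l (suc (suc q))))
-- The second cell of the upper pair reads `o`, so the lower tiling must read `o` there as well;
-- this is why a pair can only be blanked as a whole.
≼⇒⊑ (blank (letter i t))   (pair u)     l with l (suc zero)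
... | inj₁ ()
... | inj₂ ()
≼⇒⊑ (blank (pair t))       (pair u)     l with l (suc zero)
... | inj₁ ()
... | inj₂ ()
≼⇒⊑ (letter i t)           (blank u)    l with l zero
... | inj₁ ()
... | inj₂ ()
≼⇒⊑ (letter i t)           (letter j u) l with l zero
... | inj₂ refl = letter (≼⇒⊑ t u (l ∘ suc))
≼⇒⊑ (letter i t)           (pair u)     l with l zero
... | inj₁ ()
... | inj₂ ()
≼⇒⊑ (pair t)               (blank u)    l with l zero
... | inj₁ ()
... | inj₂ ()
≼⇒⊑ (pair t)               (letter j u) l with l zero
... | inj₁ ()
... | inj₂ ()
≼⇒⊑ (pair t)               (pair u)     l = pair (≼⇒⊑ t u (λ q → l (suc (suc q))))

↑⇒cell : ∀ {m n} {t u : Tiling m n} → t ↑ u →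
  ∃ λ q → at t q ≡ o × at u q ≢ o × (∀ r → r ≢ q → at t r ≡ at u r)
↑⇒cell raise-letter = zero , refl , (λ ()) , λ
  { zero 0≢0 → contradiction refl 0≢0 ; (suc r) _ → refl }
↑⇒cell raise-pair = zero , refl , (λ ()) , λ
  { zero 0≢0 → contradiction refl 0≢0 ; (suc zero) _ → refl ; (suc (suc r)) _ → refl }
↑⇒cell (in-blank s) with q , t≡o , u≢o , off ← ↑⇒cell s = suc q , t≡o , u≢o , λ
  { zero _ → refl ; (suc r) r≢q → off r (r≢q ∘ cong suc) }
↑⇒cell (in-letter s) with q , t≡o , u≢o , off ← ↑⇒cell s = suc q , t≡o , u≢o , λ
  { zero _ → refl ; (suc r) r≢q → off r (r≢q ∘ cong suc) }
↑⇒cell (in-pair s) with q , t≡o , u≢o , off ← ↑⇒cell s = suc (suc q) , t≡o , u≢o , λ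
  { zero _ → refl ; (suc zero) _ → refl ; (suc (suc r)) r≢q → off r (r≢q ∘ cong (λ q → suc (suc q))) }

adjacent⇒Edge : ∀ {m n} {t u : Tiling m n} → t ↑ u ⊎ u ↑ t → ∃ λ q → Edge q t u
adjacent⇒Edge (inj₁ s) with q , t≡o , u≢o , off ← ↑⇒cell s = q , inj₁ (t≡o , u≢o) , off
adjacent⇒Edge (inj₂ s) with q , u≡o , t≢o , off ← ↑⇒cell s =
  q , inj₂ (u≡o , t≢o) , λ r r≢q → sym (off r r≢q)

-- Cubes spanned by chosen tiles

data Choose : ℕ → ℕ → Set where
  []   : Choose 0 0
  skip : ∀ {n p} → Choose n p → Choose (suc n) p
  take : ∀ {n p} → Choose n p → Choose (suc n) (suc p)

size : ∀ {m n} → Tiling m n → ℕ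
size ε            = 0
size (blank t)    = size t
size (letter i t) = suc (size t)
size (pair t)     = suc (size t)

-- A top vertex together with the p of its nonblank tiles that are allowed to be blanked out.
Code : ℕ → ℕ → ℕ → Set
Code m n p = Σ (Tiling m n) λ t → Choose (size t) p

subcube : ∀ {m n p} (t : Tiling m n) → Choose (size t) p → Vec Bool p → Tiling m n
subcube ε            []       x           = ε
subcube (blank t)    c        x           = blank (subcube t c x)
subcube (letter i t) (skip c) x           = letter i (subcube t c x)
subcube (letter i t) (take c) (true ∷ x)  = letter i (subcube t c x)
subcube (letter i t) (take c) (false ∷ x) = blank (subcube t c x)
subcube (pair t)     (skip c) x           = pair (subcube t c x)
subcube (pair t)     (take c) (true ∷ x)  = pair (subcube t c x)
subcube (pair t)     (take c) (false ∷ x) = blank (blank (subcube t c x))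

bottom : ∀ {m n p} (t : Tiling m n) → Choose (size t) p → Tiling m n
bottom {p = p} t c = subcube t c (replicate p false)

subcube-⊑ : ∀ {m n p} (t : Tiling m n) (c : Choose (size t) p) x → subcube t c x ⊑ t
subcube-⊑ ε            []       x           = ε
subcube-⊑ (blank t)    c        x           = blank (subcube-⊑ t c x)
subcube-⊑ (letter i t) (skip c) x           = letter (subcube-⊑ t c x)
subcube-⊑ (letter i t) (take c) (true ∷ x)  = letter (subcube-⊑ t c x)
subcube-⊑ (letter i t) (take c) (false ∷ x) = blank-letter (subcube-⊑ t c x)
subcube-⊑ (pair t)     (skip c) x           = pair (subcube-⊑ t c x)
subcube-⊑ (pair t)     (take c) (true ∷ x)  = pair (subcube-⊑ t c x)
subcube-⊑ (pair t)     (take c) (false ∷ x) = blanks-pair (subcube-⊑ t c x)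

bottom-⊑ : ∀ {m n p} (t : Tiling m n) (c : Choose (size t) p) x → bottom t c ⊑ subcube t c x
bottom-⊑ ε            []       x           = ε
bottom-⊑ (blank t)    c        x           = blank (bottom-⊑ t c x)
bottom-⊑ (letter i t) (skip c) x           = letter (bottom-⊑ t c x)
bottom-⊑ (letter i t) (take c) (true ∷ x)  = blank-letter (bottom-⊑ t c x)
bottom-⊑ (letter i t) (take c) (false ∷ x) = blank (bottom-⊑ t c x)
bottom-⊑ (pair t)     (skip c) x           = pair (bottom-⊑ t c x)
bottom-⊑ (pair t)     (take c) (true ∷ x)  = blanks-pair (bottom-⊑ t c x)
bottom-⊑ (pair t)     (take c) (false ∷ x) = blank (blank (bottom-⊑ t c x))

subcube-top : ∀ {m n p} (t : Tiling m n) (c : Choose (size t) p) → ∃ λ x → subcube t c x ≡ t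
subcube-top ε            []       = [] , refl
subcube-top (blank t)    c        with x , eq ← subcube-top t c = x , cong blank eq
subcube-top (letter i t) (skip c) with x , eq ← subcube-top t c = x , cong (letter i) eq
subcube-top (letter i t) (take c) with x , eq ← subcube-top t c = true ∷ x , cong (letter i) eq
subcube-top (pair t)     (skip c) with x , eq ← subcube-top t c = x , cong pair eq
subcube-top (pair t)     (take c) with x , eq ← subcube-top t c = true ∷ x , cong pair eq

interval⊆subcube : ∀ {m n p} {t : Tiling m n} (c : Choose (size t) p) {u} →
  bottom t c ⊑ u → u ⊑ t → ∃ λ x → subcube t c x ≡ u
interval⊆subcube []       ε         ε = [] , refl
interval⊆subcube c        (blank l) (blank g)
  with x , eq ← interval⊆subcube c l g = x , cong blank eq
interval⊆subcube (skip c) (letter l) (letter g)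
  with x , eq ← interval⊆subcube c l g = x , cong (letter _) eq
interval⊆subcube (take c) (blank-letter l) (letter g)
  with x , eq ← interval⊆subcube c l g = true ∷ x , cong (letter _) eq
interval⊆subcube (take c) (blank l) (blank-letter g)
  with x , eq ← interval⊆subcube c l g = false ∷ x , cong blank eq
interval⊆subcube (skip c) (pair l) (pair g)
  with x , eq ← interval⊆subcube c l g = x , cong pair eq
interval⊆subcube (take c) (blanks-pair l) (pair g)
  with x , eq ← interval⊆subcube c l g = true ∷ x , cong pair eq
interval⊆subcube (take c) (blank (blank l)) (blanks-pair g)
  with x , eq ← interval⊆subcube c l g = false ∷ x , cong blank (cong blank eq)

-- The dimension is an output: each tile of `t` that `b` shows as blank contributes one `take`.
⊑⇒bottom : ∀ {m n} {b t : Tiling m n} → b ⊑ t → ∃₂ λ p (c : Choose (size t) p) → bottom t c ≡ b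
⊑⇒bottom ε                = _ , [] , refl
⊑⇒bottom (blank l)        with _ , c , eq ← ⊑⇒bottom l = _ , c , cong blank eq
⊑⇒bottom (letter l)       with _ , c , eq ← ⊑⇒bottom l = _ , skip c , cong (letter _) eq
⊑⇒bottom (pair l)         with _ , c , eq ← ⊑⇒bottom l = _ , skip c , cong pair eq
⊑⇒bottom (blank-letter l) with _ , c , eq ← ⊑⇒bottom l = _ , take c , cong blank eq
⊑⇒bottom (blanks-pair l)  with _ , c , eq ← ⊑⇒bottom l = _ , take c , cong blank (cong blank eq)

blank-injective : ∀ {m n} {t u : Tiling m n} → blank t ≡ blank u → t ≡ u
blank-injective refl = refl

letter-injective : ∀ {m n i j} {t u : Tiling m n} → letter i t ≡ letter j u → t ≡ u
letter-injective refl = refl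

pair-injective : ∀ {m n} {t u : Tiling m n} → pair t ≡ pair u → t ≡ u
pair-injective refl = refl

bottom-injective : ∀ {m n p} (t : Tiling m n) (c c′ : Choose (size t) p) →
  bottom t c ≡ bottom t c′ → c ≡ c′
bottom-injective ε            []       []        eq = refl
bottom-injective (blank t)    c        c′        eq = bottom-injective t c c′ (blank-injective eq)
bottom-injective (letter i t) (skip c) (skip c′) eq =
  cong skip (bottom-injective t c c′ (letter-injective eq))
bottom-injective (letter i t) (take c) (take c′) eq =
  cong take (bottom-injective t c c′ (blank-injective eq))
bottom-injective (pair t)     (skip c) (skip c′) eq =
  cong skip (bottom-injective t c c′ (pair-injective eq))
bottom-injective (pair t)     (take c) (take c′) eq =
  cong take (bottom-injective t c c′ (blank-injective (blank-injective eq)))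

subcube-injective : ∀ {m n p} (t : Tiling m n) (c : Choose (size t) p) {x y} →
  subcube t c x ≡ subcube t c y → x ≡ y
subcube-injective ε            []       {[]}        {[]}        eq = refl
subcube-injective (blank t)    c                                eq =
  subcube-injective t c (blank-injective eq)
subcube-injective (letter i t) (skip c)                         eq =
  subcube-injective t c (letter-injective eq)
subcube-injective (letter i t) (take c) {true ∷ x}  {true ∷ y}  eq =
  cong (true ∷_) (subcube-injective t c (letter-injective eq))
subcube-injective (letter i t) (take c) {false ∷ x} {false ∷ y} eq =
  cong (false ∷_) (subcube-injective t c (blank-injective eq))
subcube-injective (pair t)     (skip c)                         eq =
  subcube-injective t c (pair-injective eq)
subcube-injective (pair t)     (take c) {true ∷ x}  {true ∷ y}  eq =
  cong (true ∷_) (subcube-injective t c (pair-injective eq))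
subcube-injective (pair t)     (take c) {false ∷ x} {false ∷ y} eq =
  cong (false ∷_) (subcube-injective t c (blank-injective (blank-injective eq)))

subcube-flip : ∀ {m n p} (t : Tiling m n) (c : Choose (size t) p) x i →
  subcube t c x ↑ subcube t c (flip i x) ⊎ subcube t c (flip i x) ↑ subcube t c x
subcube-flip ε            []       []          ()
subcube-flip (blank t)    c        x           i       = map⊎ in-blank in-blank (subcube-flip t c x i)
subcube-flip (letter i t) (skip c) x           j       = map⊎ in-letter in-letter (subcube-flip t c x j)
subcube-flip (letter i t) (take c) (true ∷ x)  zero    = inj₂ raise-letter
subcube-flip (letter i t) (take c) (false ∷ x) zero    = inj₁ raise-letter
subcube-flip (letter i t) (take c) (true ∷ x)  (suc j) = map⊎ in-letter in-letter (subcube-flip t c x j)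
subcube-flip (letter i t) (take c) (false ∷ x) (suc j) = map⊎ in-blank in-blank (subcube-flip t c x j)
subcube-flip (pair t)     (skip c) x           j       = map⊎ in-pair in-pair (subcube-flip t c x j)
subcube-flip (pair t)     (take c) (true ∷ x)  zero    = inj₂ raise-pair
subcube-flip (pair t)     (take c) (false ∷ x) zero    = inj₁ raise-pair
subcube-flip (pair t)     (take c) (true ∷ x)  (suc j) = map⊎ in-pair in-pair (subcube-flip t c x j)
subcube-flip (pair t)     (take c) (false ∷ x) (suc j) =
  map⊎ (in-blank ∘ in-blank) (in-blank ∘ in-blank) (subcube-flip t c x j)

↑-blank⁻¹ : ∀ {m n} {t u : Tiling m n} → blank t ↑ blank u → t ↑ u
↑-blank⁻¹ (in-blank s) = s

↑-letter⁻¹ : ∀ {m n i} {t u : Tiling m n} → letter i t ↑ letter i u → t ↑ u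
↑-letter⁻¹ (in-letter s) = s

↑-pair⁻¹ : ∀ {m n} {t u : Tiling m n} → pair t ↑ pair u → t ↑ u
↑-pair⁻¹ (in-pair s) = s

raise-letter⁻¹ : ∀ {m n i} {t u : Tiling m n} → blank t ↑ letter i u → t ≡ u
raise-letter⁻¹ raise-letter = refl

raise-pair⁻¹ : ∀ {m n} {t u : Tiling m n} → blank (blank t) ↑ pair u → t ≡ u
raise-pair⁻¹ raise-pair = refl

-- This makes the cube an induced subgraph. Where the leading tiles agree the step lies further on;
-- where a chosen tile is raised the remainders are equal, and `subcube-injective` makes the
-- remaining bits equal too.
subcube-↑⇒flip : ∀ {m n p} (t : Tiling m n) (c : Choose (size t) p) {x y} →
  subcube t c x ↑ subcube t c y → ∃ λ i → y ≡ flip i x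
subcube-↑⇒flip ε            []       ()
subcube-↑⇒flip (blank t)    c        s = subcube-↑⇒flip t c (↑-blank⁻¹ s)
subcube-↑⇒flip (letter i t) (skip c) s = subcube-↑⇒flip t c (↑-letter⁻¹ s)
subcube-↑⇒flip (letter i t) (take c) {true ∷ x} {true ∷ y} s
  with j , refl ← subcube-↑⇒flip t c (↑-letter⁻¹ s) = suc j , refl
subcube-↑⇒flip (letter i t) (take c) {false ∷ x} {true ∷ y} s
  with refl ← subcube-injective t c {x} {y} (raise-letter⁻¹ s) = zero , refl
subcube-↑⇒flip (letter i t) (take c) {true ∷ x} {false ∷ y} ()
subcube-↑⇒flip (letter i t) (take c) {false ∷ x} {false ∷ y} s
  with j , refl ← subcube-↑⇒flip t c (↑-blank⁻¹ s) = suc j , refl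
subcube-↑⇒flip (pair t) (skip c) s = subcube-↑⇒flip t c (↑-pair⁻¹ s)
subcube-↑⇒flip (pair t) (take c) {true ∷ x} {true ∷ y} s
  with j , refl ← subcube-↑⇒flip t c (↑-pair⁻¹ s) = suc j , refl
subcube-↑⇒flip (pair t) (take c) {false ∷ x} {true ∷ y} s
  with refl ← subcube-injective t c {x} {y} (raise-pair⁻¹ s) = zero , refl
subcube-↑⇒flip (pair t) (take c) {true ∷ x} {false ∷ y} ()
subcube-↑⇒flip (pair t) (take c) {false ∷ x} {false ∷ y} s
  with j , refl ← subcube-↑⇒flip t c (↑-blank⁻¹ (↑-blank⁻¹ s)) = suc j , refl

Vec-Bool↔Fin : ∀ p → Vec Bool p ↔ Fin (2 ^ p)
Vec-Bool↔Fin zero    = mk↔ₛ′ (λ _ → zero) (λ _ → []) (λ { zero → refl }) (λ { [] → refl })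
Vec-Bool↔Fin (suc p) = ↔-trans uncons (↔-trans (↔-sym 2↔Bool ×-↔ Vec-Bool↔Fin p) (↔-sym *↔×))
  where
  uncons : Vec Bool (suc p) ↔ (Bool × Vec Bool p)
  uncons = mk↔ₛ′ (λ { (a ∷ x) → a , x }) (λ { (a , x) → a ∷ x }) (λ _ → refl) (λ { (_ ∷ _) → refl })

-- Pigeonhole: for `q < p` there would be an injection from `2 ^ p` elements into the fewer `2 ^ q`.
Vec-Bool-injection⇒≤ : ∀ {p q} (f : Vec Bool p → Vec Bool q) →
  (∀ {x y} → f x ≡ f y → x ≡ y) → p ≤ q
Vec-Bool-injection⇒≤ {p} {q} f f-injective = ≮⇒≥ λ q<p →
  <⇒≱ (^-monoʳ-< 2 ≤-refl q<p) (injective⇒≤ {f = to (Vec-Bool↔Fin q) ∘ f ∘ from (Vec-Bool↔Fin p)}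
    (injective (↔⇒↣ (↔-sym (Vec-Bool↔Fin p))) ∘ f-injective ∘ injective (↔⇒↣ (Vec-Bool↔Fin q))))
  where
  open Inverse using (to; from)
  open Injection using (injective)

-- Tilings as Pell strings

-- `inject₁` stays below the top element and `suc` avoids `zero`, so the image consists of the
-- characters other than `0` and `k`.
glyph : ∀ {m} → Fin m → Fin (suc (suc m))
glyph i = suc (inject₁ i)

encode : ∀ {m n} → Tiling m n → Word n (suc m)
encode ε            = []
encode (blank t)    = zero ∷ encode t
encode (letter i t) = glyph i ∷ encode t
encode (pair t)     = fromℕ _ ∷ fromℕ _ ∷ encode t

glyph≢k : ∀ {m} {i : Fin m} → glyph i ≢ fromℕ (suc m)
glyph≢k = fromℕ≢inject₁ ∘ sym ∘ suc-injective

encode-injective : ∀ {m n} {t u : Tiling m n} → encode t ≡ encode u → t ≡ u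
encode-injective {t = ε}          {ε}          eq = refl
encode-injective {t = blank t}    {blank u}    eq = cong blank (encode-injective (Vec.∷-injectiveʳ eq))
encode-injective {t = letter i t} {letter j u} eq with head-eq , tail-eq ← ∷-injective eq =
  cong₂ letter (inject₁-injective (suc-injective head-eq)) (encode-injective tail-eq)
encode-injective {t = letter i t} {pair u}     eq = contradiction (Vec.∷-injectiveˡ eq) glyph≢k
encode-injective {t = pair t}     {letter j u} eq = contradiction (sym (Vec.∷-injectiveˡ eq)) glyph≢k
encode-injective {t = pair t}     {pair u}     eq =
  cong pair (encode-injective (Vec.∷-injectiveʳ (Vec.∷-injectiveʳ eq)))

encode-↑ : ∀ {m n} {t u : Tiling m n} → t ↑ u → encode t ⟶ encode u
encode-↑ raise-letter  = 0⟶i _ (λ ()) glyph≢k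
encode-↑ raise-pair    = 00⟶kk
encode-↑ (in-blank s)  = there _ (encode-↑ s)
encode-↑ (in-letter s) = there _ (encode-↑ s)
encode-↑ (in-pair s)   = there _ (there _ (encode-↑ s))

module _ {m n : ℕ} where

  ⟶-tail : ∀ {a} {w w′ : Word n (suc m)} → a ∷ w ⟶ a ∷ w′ → w ⟶ w′
  ⟶-tail (0⟶i _ 0≢0 _) = contradiction refl 0≢0
  ⟶-tail (there _ s)   = s

  ⟶-head : ∀ {a b} {w w′ : Word n (suc m)} → a ≢ zero → a ∷ w ⟶ b ∷ w′ → a ≡ b
  ⟶-head a≢0 (0⟶i _ _ _) = contradiction refl a≢0
  ⟶-head a≢0 00⟶kk       = contradiction refl a≢0
  ⟶-head a≢0 (there _ _) = refl

  0⟶i⁻¹ : ∀ {b} {w w′ : Word n (suc m)} → b ≢ zero → b ≢ fromℕ _ → zero ∷ w ⟶ b ∷ w′ → w ≡ w′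
  0⟶i⁻¹ b≢0 b≢k (0⟶i _ _ _) = refl
  0⟶i⁻¹ b≢0 b≢k 00⟶kk       = contradiction refl b≢k
  0⟶i⁻¹ b≢0 b≢k (there _ _) = contradiction refl b≢0

  00⟶kk⁻¹ : ∀ {b c w} {w′ : Word n (suc m)} → b ≡ fromℕ _ → zero ∷ w ⟶ b ∷ c ∷ w′ → w ≡ zero ∷ w′
  00⟶kk⁻¹ b≡k (0⟶i _ _ b≢k) = contradiction b≡k b≢k
  00⟶kk⁻¹ b≡k 00⟶kk         = refl
  00⟶kk⁻¹ ()  (there _ _)

encode-↑⁻¹ : ∀ {m n} (t u : Tiling m n) → encode t ⟶ encode u → t ↑ u
encode-↑⁻¹ ε            ε            ()
encode-↑⁻¹ (blank t)    (blank u)    s = in-blank (encode-↑⁻¹ t u (⟶-tail s))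
encode-↑⁻¹ (blank t)    (letter i u) s
  with refl ← encode-injective {t = t} {u} (0⟶i⁻¹ (λ ()) glyph≢k s) = raise-letter
encode-↑⁻¹ (blank t)    (pair u)     s
  with refl ← encode-injective {t = t} {blank u} (00⟶kk⁻¹ refl s) = raise-pair
encode-↑⁻¹ (letter i t) (blank u)    s = contradiction (⟶-head (λ ()) s) λ ()
encode-↑⁻¹ (letter i t) (letter j u) s
  with refl ← inject₁-injective (suc-injective (⟶-head (λ ()) s)) = in-letter (encode-↑⁻¹ t u (⟶-tail s))
encode-↑⁻¹ (letter i t) (pair u)     s = contradiction (⟶-head (λ ()) s) glyph≢k
encode-↑⁻¹ (pair t)     (blank u)    s = contradiction (⟶-head (λ ()) s) λ ()
encode-↑⁻¹ (pair t)     (letter j u) s = contradiction (sym (⟶-head (λ ()) s)) glyph≢k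
encode-↑⁻¹ (pair t)     (pair u)     s = in-pair (encode-↑⁻¹ t u (⟶-tail (⟶-tail s)))

-- Even runs and parsing

last-∷ : ∀ {A : Set} {a x : A} u → last u ≡ just x → last (a ∷ u) ≡ just x
last-∷ (_ ∷ _) eq = eq

last-∷⁻¹ : ∀ {A : Set} {a x : A} u → a ≢ x → last (a ∷ u) ≡ just x → last u ≡ just x
last-∷⁻¹ []      a≢x refl = contradiction refl a≢x
last-∷⁻¹ (_ ∷ _) a≢x eq   = eq

module _ {m : ℕ} where

  private
    k : Fin (suc (suc m))
    k = fromℕ (suc m)

  EvenRuns-∷ : ∀ {n a} {w : Word n (suc m)} → a ≢ k → EvenRuns w → EvenRuns (a ∷ w)
  EvenRuns-∷ a≢k even []      zero    v eq _   _   = 2 ∣0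
  EvenRuns-∷ a≢k even []      (suc r) v eq _   _   = contradiction (List.∷-injectiveˡ eq) a≢k
  EvenRuns-∷ a≢k even (_ ∷ u) r       v eq u≢k v≢k =
    even u r v (List.∷-injectiveʳ eq) (u≢k ∘ last-∷ u) v≢k

  EvenRuns-∷⁻¹ : ∀ {n a} {w : Word n (suc m)} → a ≢ k → EvenRuns (a ∷ w) → EvenRuns w
  EvenRuns-∷⁻¹ a≢k even u r v eq u≢k v≢k =
    even (_ ∷ u) r v (cong (_ ∷_) eq) (u≢k ∘ last-∷⁻¹ u a≢k) v≢k

  -- A run at the front has length at least two, because `v` may not begin with `k`, and loses two
  -- on passing to `w`. No maximal run starts after the first `k` alone. Every longer prefix `u`
  -- loses its first two characters.
  EvenRuns-kk : ∀ {n} {w : Word n (suc m)} → EvenRuns w → EvenRuns (k ∷ k ∷ w)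
  EvenRuns-kk even []          zero          v eq _   v≢k = contradiction (cong List.head (sym eq)) v≢k
  EvenRuns-kk even []          (suc zero)    v eq _   v≢k =
    contradiction (cong List.head (sym (List.∷-injectiveʳ eq))) v≢k
  EvenRuns-kk even []          (suc (suc r)) v eq u≢k v≢k =
    ∣m∣n⇒∣m+n ∣-refl (even [] r v (List.∷-injectiveʳ (List.∷-injectiveʳ eq)) u≢k v≢k)
  EvenRuns-kk even (a ∷ [])    r             v eq u≢k _   =
    contradiction (cong just (sym (List.∷-injectiveˡ eq))) u≢k
  EvenRuns-kk even (_ ∷ b ∷ u) r             v eq u≢k v≢k =
    even u r v (List.∷-injectiveʳ (List.∷-injectiveʳ eq)) (u≢k ∘ last-∷ {a = b} u) v≢k

  -- A run at the front of `w` merges with the two new characters, so its length grows by two; a run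
  -- further on keeps its length, its prefix being extended by `kk`.
  EvenRuns-kk⁻¹ : ∀ {n} {w : Word n (suc m)} → EvenRuns (k ∷ k ∷ w) → EvenRuns w
  EvenRuns-kk⁻¹ even []      r v eq u≢k v≢k =
    ∣m+n∣m⇒∣n (even [] (suc (suc r)) v (cong (λ w → k ∷ k ∷ w) eq) u≢k v≢k) (∣-refl {2})
  EvenRuns-kk⁻¹ even (a ∷ u) r v eq u≢k v≢k =
    even (k ∷ k ∷ a ∷ u) r v (cong (λ w → k ∷ k ∷ w) eq) u≢k v≢k

  EvenRuns-singleton : ¬ EvenRuns (k ∷ [])
  EvenRuns-singleton even = >⇒∤ ≤-refl (even [] 1 [] refl (λ ()) (λ ()))

  EvenRuns-single : ∀ {n b} {w : Word n (suc m)} → b ≢ k → ¬ EvenRuns (k ∷ b ∷ w)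
  EvenRuns-single b≢k even = >⇒∤ ≤-refl (even [] 1 _ refl (λ ()) λ { refl → b≢k refl })

encode-EvenRuns : ∀ {m n} (t : Tiling m n) → EvenRuns (encode t)
encode-EvenRuns ε            []      zero    v eq _ _ = 2 ∣0
encode-EvenRuns (blank t)    = EvenRuns-∷ (λ ()) (encode-EvenRuns t)
encode-EvenRuns (letter i t) = EvenRuns-∷ glyph≢k (encode-EvenRuns t)
encode-EvenRuns (pair t)     = EvenRuns-kk (encode-EvenRuns t)

-- Evenness is refuted in the failing branch rather than consumed as an argument: in a `PellString`
-- its proof is irrelevant, so it may serve only to discard that branch.
parse : ∀ {m n} (w : Word n (suc m)) → (∃ λ t → encode t ≡ w) ⊎ ¬ EvenRuns w
parse []          = inj₁ (ε , refl)
parse (zero ∷ w)  with parse w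
... | inj₁ (t , refl) = inj₁ (blank t , refl)
... | inj₂ ¬even      = inj₂ (¬even ∘ EvenRuns-∷⁻¹ (λ ()))
parse (suc a ∷ w) with view a
parse (suc a ∷ w) | ‵inject₁ i with parse w
... | inj₁ (t , refl) = inj₁ (letter i t , refl)
... | inj₂ ¬even      = inj₂ (¬even ∘ EvenRuns-∷⁻¹ glyph≢k)
parse (suc a ∷ [])        | ‵fromℕ = inj₂ EvenRuns-singleton
parse (suc a ∷ zero ∷ w)  | ‵fromℕ = inj₂ (EvenRuns-single λ ())
parse (suc a ∷ suc b ∷ w) | ‵fromℕ with view b
... | ‵inject₁ i = inj₂ (EvenRuns-single glyph≢k)
... | ‵fromℕ with parse w
...   | inj₁ (t , refl) = inj₁ (pair t , refl)
...   | inj₂ ¬even      = inj₂ (¬even ∘ EvenRuns-kk⁻¹)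

toPell : ∀ {m n} → Tiling m n → PellString n (suc m)
toPell t = pell (encode t) (encode-EvenRuns t)

parsePell : ∀ {m n} (x : PellString n (suc m)) → ∃ λ t → encode t ≡ word x
parsePell (pell w even) with parse w
... | inj₁ t     = t
... | inj₂ ¬even = contradiction-irr even ¬even

fromPell : ∀ {m n} → PellString n (suc m) → Tiling m n
fromPell = proj₁ ∘ parsePell

word-injective : ∀ {n k} {x y : PellString n k} → word x ≡ word y → x ≡ y
word-injective refl = refl

toPell-fromPell : ∀ {m n} (x : PellString n (suc m)) → toPell (fromPell x) ≡ x
toPell-fromPell x = word-injective (proj₂ (parsePell x))

fromPell-toPell : ∀ {m n} (t : Tiling m n) → fromPell (toPell t) ≡ t
fromPell-toPell t = encode-injective (proj₂ (parsePell (toPell t)))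

-- Induced hypercubes of the Munarini graph

Hypercube-flip : ∀ {p} (i : Fin p) x → Adj (Hypercube p) x (flip i x)
Hypercube-flip i x = i , lookup-flip i x ∘ sym , λ j j≢i → sym (lookup∘updateAt′ j i j≢i x)

Hypercube-adjacent⇒flip : ∀ {p x y} → Adj (Hypercube p) x y → ∃ λ i → y ≡ flip i x
Hypercube-adjacent⇒flip {x = x} {y} (i , x≢y , x≡y) =
  i , trans (sym (tabulate∘lookup y)) (trans (tabulate-cong pointwise) (tabulate∘lookup (flip i x)))
  where
  pointwise : ∀ j → lookup y j ≡ lookup (flip i x) j
  pointwise j with j ≟ᶠ i
  ... | yes refl = trans (¬-not (x≢y ∘ sym)) (sym (lookup∘updateAt i x))
  ... | no  j≢i  = trans (sym (x≡y j j≢i)) (sym (lookup∘updateAt′ j i j≢i x))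

-- Vertex sets are Boolean-valued, so membership in the image of a cube has to be decided; this is
-- done by searching all bit vectors.
any-Vec-Bool? : ∀ {p} {P : Vec Bool p → Set} → (∀ x → Dec (P x)) → Dec (∃ P)
any-Vec-Bool? {zero}  P? = map′ ([] ,_) (λ { ([] , Px) → Px }) (P? [])
any-Vec-Bool? {suc p} P? =
  map′ (λ { (inj₁ (x , Px)) → true ∷ x , Px ; (inj₂ (x , Px)) → false ∷ x , Px })
       (λ { (true ∷ x , Px) → inj₁ (x , Px) ; (false ∷ x , Px) → inj₂ (x , Px) })
       (any-Vec-Bool? (P? ∘ (true ∷_)) ⊎-dec any-Vec-Bool? (P? ∘ (false ∷_)))

_≟ᵗ_ : ∀ {m n} (t u : Tiling m n) → Dec (t ≡ u)
t ≟ᵗ u = map′ encode-injective (cong encode) (Vec.≡-dec _≟ᶠ_ (encode t) (encode u))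

induced-≡ : ∀ {G S} {x y : Vertex (induced G S)} → proj₁ x ≡ proj₁ y → x ≡ y
induced-≡ {x = x , _} refl = cong (x ,_) (T-irrelevant _ _)

T-ext : ∀ {a b} → (T a → T b) → (T b → T a) → a ≡ b
T-ext {true}  {true}  _ _ = refl
T-ext {true}  {false} f _ = contradiction (f _) id
T-ext {false} {true}  _ g = contradiction (g _) id
T-ext {false} {false} _ _ = refl

module _ {m n : ℕ} where

  private
    M : Graph
    M = Munarini n (suc m)

  adjacent⇒tiling : ∀ (x y : PellString n (suc m)) → Adj M x y →
    fromPell x ↑ fromPell y ⊎ fromPell y ↑ fromPell x
  adjacent⇒tiling x y
    with t , eqt ← parsePell x | u , equ ← parsePell y =
    map⊎ (λ s → encode-↑⁻¹ t u (subst₂ _⟶_ (sym eqt) (sym equ) s))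
         (λ s → encode-↑⁻¹ u t (subst₂ _⟶_ (sym equ) (sym eqt) s))

  module _ {p : ℕ} (t : Tiling m n) (c : Choose (size t) p) where

    subcube? : ∀ u → Dec (∃ λ x → subcube t c x ≡ u)
    subcube? u = any-Vec-Bool? λ x → subcube t c x ≟ᵗ u

    cubeSet : VertexSet M
    cubeSet x = isYes (subcube? (fromPell x))

    ∈-cubeSet : ∀ u x → subcube t c x ≡ u → T (cubeSet (toPell u))
    ∈-cubeSet u x eq = fromWitness (x , trans eq (sym (fromPell-toPell u)))

    cubeSet-≅ : induced M cubeSet ≅ Hypercube p
    cubeSet-≅ = record
      { bijection = mk↔ₛ′ to from to∘from from∘to
      ; adjacency = λ x y → mk⇔ (to-adjacent x y) (from-adjacent x y)
      }
      where
      to : Vertex (induced M cubeSet) → Vec Bool p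
      to (x , x∈) = proj₁ (toWitness x∈)

      subcube-to : ∀ x → subcube t c (to x) ≡ fromPell (proj₁ x)
      subcube-to (x , x∈) = proj₂ (toWitness x∈)

      from : Vec Bool p → Vertex (induced M cubeSet)
      from x = toPell (subcube t c x) , ∈-cubeSet _ x refl

      to∘from : ∀ x → to (from x) ≡ x
      to∘from x = subcube-injective t c (trans (subcube-to (from x)) (fromPell-toPell _))

      from∘to : ∀ x → from (to x) ≡ x
      from∘to x = induced-≡ {M} {cubeSet}
        (trans (cong toPell (subcube-to x)) (toPell-fromPell (proj₁ x)))

      to-adjacent : ∀ x y → Adj M (proj₁ x) (proj₁ y) → Adj (Hypercube p) (to x) (to y)
      to-adjacent x y adj
        with subst₂ (λ u v → u ↑ v ⊎ v ↑ u) (sym (subcube-to x)) (sym (subcube-to y))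
               (adjacent⇒tiling (proj₁ x) (proj₁ y) adj)
      ... | inj₁ s with i , eq ← subcube-↑⇒flip t c s =
        subst (Adj (Hypercube p) (to x)) (sym eq) (Hypercube-flip i (to x))
      ... | inj₂ s with i , eq ← subcube-↑⇒flip t c s = Adj-sym (Hypercube p) {to y} {to x}
        (subst (Adj (Hypercube p) (to y)) (sym eq) (Hypercube-flip i (to y)))

      from-adjacent : ∀ x y → Adj (Hypercube p) (to x) (to y) → Adj M (proj₁ x) (proj₁ y)
      from-adjacent x y adj
        with i , eq ← Hypercube-adjacent⇒flip adj =
        map⊎ (up x y) (up y x) (subst₂ (λ u v → u ↑ v ⊎ v ↑ u) (subcube-to x)
                      (trans (cong (subcube t c) (sym eq)) (subcube-to y))
                      (subcube-flip t c (to x) i))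
        where
        up : ∀ x y → fromPell (proj₁ x) ↑ fromPell (proj₁ y) → word (proj₁ x) ⟶ word (proj₁ y)
        up (x , _) (y , _) s = subst₂ _⟶_ (proj₂ (parsePell x)) (proj₂ (parsePell y)) (encode-↑ s)

  cubeSet⁻¹ : ∀ {p} {t : Tiling m n} {c : Choose (size t) p} {u} →
    T (cubeSet t c (toPell u)) → ∃ λ x → subcube t c x ≡ u
  cubeSet⁻¹ u∈ with x , eq ← toWitness u∈ = x , trans eq (fromPell-toPell _)

  -- The smaller set contains its own top and bottom, and as members of the larger one these lie
  -- between the bounds of the latter.
  cubeSet-⊆⇒⊑ : ∀ {p} {t t′ : Tiling m n} {c : Choose (size t) p} {c′ : Choose (size t′) p} →
    (∀ x → T (cubeSet t c x) → T (cubeSet t′ c′ x)) → t ⊑ t′ × bottom t′ c′ ⊑ bottom t c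
  cubeSet-⊆⇒⊑ {t = t} {t′} {c} {c′} sub
    with x , top≡ ← subcube-top t c
    with y , top∈ ← cubeSet⁻¹ {c = c′} (sub (toPell t) (∈-cubeSet t c t x top≡))
       | z , bottom∈ ← cubeSet⁻¹ {c = c′} (sub (toPell (bottom t c)) (∈-cubeSet t c _ _ refl)) =
    subst (_⊑ t′) top∈ (subcube-⊑ t′ c′ y) , subst (bottom t′ c′ ⊑_) bottom∈ (bottom-⊑ t′ c′ z)

  cubeSet-injective : ∀ {p} {t t′ : Tiling m n} {c : Choose (size t) p} {c′ : Choose (size t′) p} →
    (∀ x → cubeSet t c x ≡ cubeSet t′ c′ x) → (t , c) ≡ (t′ , c′)
  cubeSet-injective {t = t} {c = c} {c′} same
    with t⊑t′ , b′⊑b ← cubeSet-⊆⇒⊑ {c = c} {c′} (λ x → subst T (same x))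
       | t′⊑t , b⊑b′ ← cubeSet-⊆⇒⊑ {c = c′} {c} (λ x → subst T (sym (same x)))
    with refl ← ⊑-antisym t⊑t′ t′⊑t =
    cong (t ,_) (bottom-injective t c c′ (⊑-antisym b⊑b′ b′⊑b))

  -- Every induced hypercube comes from a code

  module _ {p : ℕ} {S : VertexSet M} (iso : induced M S ≅ Hypercube p) where
    open _≅_ iso
    open Inverse bijection using (to; from; strictlyInverseˡ; strictlyInverseʳ)

    embed : Vec Bool p → Tiling m n
    embed x = fromPell (proj₁ (from x))

    embed-injective : ∀ {x y} → embed x ≡ embed y → x ≡ y
    embed-injective {x} {y} eq = trans (sym (strictlyInverseˡ x))
      (trans (cong to (induced-≡ {M} {S} vertex≡)) (strictlyInverseˡ y))
      where
      vertex≡ : proj₁ (from x) ≡ proj₁ (from y)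
      vertex≡ = trans (sym (toPell-fromPell _)) (trans (cong toPell eq) (toPell-fromPell _))

    embed-edge : ∀ x i → ∃ λ q → Edge q (embed x) (embed (flip i x))
    embed-edge x i = adjacent⇒Edge (adjacent⇒tiling _ _ (Equivalence.from (adjacency _ _)
      (subst₂ (Adj (Hypercube p)) (sym (strictlyInverseˡ x)) (sym (strictlyInverseˡ (flip i x)))
        (Hypercube-flip i x))))

    embed∈ : ∀ {u} x → embed x ≡ u → T (S (toPell u))
    embed∈ x refl = subst (T ∘ S) (sym (toPell-fromPell _)) (proj₂ (from x))

    embed⁻¹ : ∀ {u} → T (S (toPell u)) → ∃ λ x → embed x ≡ u
    embed⁻¹ {u} u∈ = to (toPell u , u∈) ,
      trans (cong (fromPell ∘ proj₁) (strictlyInverseʳ (toPell u , u∈))) (fromPell-toPell u)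

    module _ {b t : Tiling m n} (image⊆ : ∀ x → b ≼ embed x × embed x ≼ t)
             (⊆image : ∀ u → b ≼ u → u ≼ t → ∃ λ x → embed x ≡ u)
             {p′ : ℕ} (c : Choose (size t) p′) (bottom≡ : bottom t c ≡ b) where

      image⊆subcube : ∀ x → ∃ λ y → subcube t c y ≡ embed x
      image⊆subcube x = interval⊆subcube c
        (subst (_⊑ embed x) (sym bottom≡) (≼⇒⊑ _ _ (proj₁ (image⊆ x)))) (≼⇒⊑ _ _ (proj₂ (image⊆ x)))

      subcube⊆image : ∀ y → ∃ λ x → embed x ≡ subcube t c y
      subcube⊆image y = ⊆image _
        (⊑⇒≼ (subst (_⊑ subcube t c y) bottom≡ (bottom-⊑ t c y)))
        (⊑⇒≼ (subcube-⊑ t c y))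

      -- One interval is the image of both cubes, and both maps onto it are injective, so the vertex
      -- sets of the cubes inject into each other.
      dimension-unique : p ≡ p′
      dimension-unique = ≤-antisym
        (Vec-Bool-injection⇒≤ (proj₁ ∘ image⊆subcube) λ {x} {y} eq → embed-injective
          (trans (sym (proj₂ (image⊆subcube x)))
            (trans (cong (subcube t c) eq) (proj₂ (image⊆subcube y)))))
        (Vec-Bool-injection⇒≤ (proj₁ ∘ subcube⊆image) λ {x} {y} eq → subcube-injective t c
          (trans (sym (proj₂ (subcube⊆image x)))
            (trans (cong embed eq) (proj₂ (subcube⊆image y)))))

      cubeSet-≡ : ∀ u → cubeSet t c (toPell u) ≡ S (toPell u)
      cubeSet-≡ u = T-ext to-S from-S
        where
        to-S : T (cubeSet t c (toPell u)) → T (S (toPell u))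
        to-S u∈ with y , y≡ ← cubeSet⁻¹ {c = c} u∈ with x , x≡ ← subcube⊆image y =
          embed∈ x (trans x≡ y≡)
        from-S : T (S (toPell u)) → T (cubeSet t c (toPell u))
        from-S u∈ with x , x≡ ← embed⁻¹ u∈ with y , y≡ ← image⊆subcube x =
          ∈-cubeSet t c u y (trans y≡ x≡)

    copy-is-cubeSet : Σ (Tiling m n) λ t → Σ (Choose (size t) p) λ c → ∀ x → cubeSet t c x ≡ S x
    copy-is-cubeSet =
      let b , t , b≼t , image⊆ , ⊆image = image-is-interval embed embed-injective embed-edge
          p′ , c , bottom≡ = ⊑⇒bottom (≼⇒⊑ b t b≼t)
      in finish image⊆ ⊆image c bottom≡ (dimension-unique image⊆ ⊆image c bottom≡)
      where
      -- With `p′` a variable, matching the equation `p ≡ p′` turns `c` into a choice of `p` tiles.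
      finish : ∀ {b t} → (∀ x → b ≼ embed x × embed x ≼ t) →
        (∀ u → b ≼ u → u ≼ t → ∃ λ x → embed x ≡ u) →
        ∀ {p′} (c : Choose (size t) p′) → bottom t c ≡ b → p ≡ p′ →
        Σ (Tiling m n) λ t → Σ (Choose (size t) p) λ c → ∀ x → cubeSet t c x ≡ S x
      finish {t = t} image⊆ ⊆image c bottom≡ refl = t , c , λ x →
        subst (λ x → cubeSet t c x ≡ S x) (toPell-fromPell x)
              (cubeSet-≡ image⊆ ⊆image c bottom≡ (fromPell x))

  codes↔copies : ∀ p → Inverse (setoid (Code m n p)) (InducedCopies (Hypercube p) M)
  codes↔copies p = Bijection⇒Inverse record
    { to        = λ (t , c) → cubeSet t c , cubeSet-≅ t c
    ; cong      = λ { refl x → refl }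
    ; bijective = (λ {(t , c)} {(t′ , c′)} → cubeSet-injective {c = c} {c′})
                , λ (S , iso) → respects {S} (copy-is-cubeSet iso)
    }
    where
    respects : ∀ {S : VertexSet M} →
      (Σ (Tiling m n) λ t → Σ (Choose (size t) p) λ c → ∀ x → cubeSet t c x ≡ S x) →
      ∃ λ (d : Code m n p) → ∀ {e : Code m n p} → e ≡ d → ∀ x → cubeSet (proj₁ e) (proj₂ e) x ≡ S x
    respects (t , c , same) = (t , c) , λ { refl → same }

-- Counting

Fin-≡ : ∀ {A : Set} {a b} → a ≡ b → A ↔ Fin a → A ↔ Fin b
Fin-≡ refl f = f

¬⇒↔Fin0 : ∀ {A : Set} → ¬ A → A ↔ Fin 0
¬⇒↔Fin0 ¬a = mk↔ₛ′ (λ a → contradiction a ¬a) (λ ()) (λ ()) (λ a → contradiction a ¬a)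

⊎↔Fin : ∀ {A B : Set} {a b} → A ↔ Fin a → B ↔ Fin b → (A ⊎ B) ↔ Fin (a + b)
⊎↔Fin f g = ↔-trans (f ⊎-↔ g) (↔-sym +↔⊎)

×↔Fin : ∀ {A B : Set} {a b} → A ↔ Fin a → B ↔ Fin b → (A × B) ↔ Fin (a * b)
×↔Fin f g = ↔-trans (f ×-↔ g) (↔-sym *↔×)

module _ {P : ℕ → Set} where

  ∃-split : ∃ P ↔ (P 0 ⊎ ∃ (P ∘ suc))
  ∃-split = mk↔ₛ′ (λ { (zero , x) → inj₁ x ; (suc i , x) → inj₂ (i , x) })
                  (λ { (inj₁ x) → zero , x ; (inj₂ (i , x)) → suc i , x })
                  (λ { (inj₁ _) → refl ; (inj₂ _) → refl })
                  (λ { (zero , _) → refl ; (suc _ , _) → refl })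

  ∃-drop : ¬ P 0 → ∃ P ↔ ∃ (P ∘ suc)
  ∃-drop ¬P0 = mk↔ₛ′ (λ { (zero , x) → contradiction x ¬P0 ; (suc i , x) → i , x })
                     (λ (i , x) → suc i , x)
                     (λ _ → refl)
                     (λ { (zero , x) → contradiction x ¬P0 ; (suc _ , _) → refl })

∃↔Fin-applyUpTo : ∀ {P : ℕ → Set} {c : ℕ → ℕ} b → (∀ i → P i ↔ Fin (c i)) →
  (∀ i → P i → i < b) → ∃ P ↔ Fin (sum (applyUpTo c b))
∃↔Fin-applyUpTo zero    f bound = ¬⇒↔Fin0 λ (i , x) → contradiction (bound i x) λ ()
∃↔Fin-applyUpTo (suc b) f bound = ↔-trans ∃-split
  (⊎↔Fin (f 0) (∃↔Fin-applyUpTo b (f ∘ suc) λ i x → s≤s⁻¹ (bound (suc i) x)))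

∃-shift : ∀ {P : ℕ → Set} a → (∀ i → P i → a ≤ i) → ∃ P ↔ ∃ (P ∘ (a +_))
∃-shift zero    bound = ↔-refl
∃-shift (suc a) bound = ↔-trans (∃-drop λ x → contradiction (bound 0 x) λ ())
                                (∃-shift a λ i x → s≤s⁻¹ (bound (suc i) x))

∃↔Fin-sumFromTo : ∀ {P : ℕ → Set} {c : ℕ → ℕ} a b → (∀ i → P i ↔ Fin (c i)) →
  (∀ i → P i → a ≤ i × i ≤ b) → ∃ P ↔ Fin (sumFromTo a b c)
∃↔Fin-sumFromTo {c = c} a b f bound =
  ↔-trans (∃-shift a λ i x → proj₁ (bound i x))
    (Fin-≡ (cong sum (sym (List.map-upTo (c ∘ (a +_)) (suc b ∸ a))))
      (∃↔Fin-applyUpTo (suc b ∸ a) (λ i → f (a + i)) λ i x →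
        -- `upTo` is exclusive, so `a + i ≤ b` is used in the form `suc i + a ≤ suc b`, which gives
        -- `i < suc b ∸ a`.
        m+n≤o⇒m≤o∸n (suc i) (s≤s (subst (_≤ b) (+-comm a i) (proj₂ (bound (a + i) x))))))

nC0≡1 : ∀ n → n C 0 ≡ 1
nC0≡1 n = trans (nCk≡nC[n∸k] {0} {n} z≤n) (nCn≡1 n)

Choose↔Fin : ∀ n p → Choose n p ↔ Fin (n C p)
Choose↔Fin zero    zero    = mk↔ₛ′ (λ _ → zero) (λ _ → []) (λ { zero → refl }) (λ { [] → refl })
Choose↔Fin zero    (suc p) = Fin-≡ (sym (k>n⇒nCk≡0 {0} {suc p} (s≤s z≤n))) (¬⇒↔Fin0 λ ())
Choose↔Fin (suc n) zero    = Fin-≡ (trans (nC0≡1 n) (sym (nC0≡1 (suc n))))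
  (↔-trans (mk↔ₛ′ (λ { (skip c) → c }) skip (λ _ → refl) (λ { (skip _) → refl })) (Choose↔Fin n 0))
Choose↔Fin (suc n) (suc p) = Fin-≡ (nCk+nC[k+1]≡[n+1]C[k+1] n p)
  (↔-trans (mk↔ₛ′ (λ { (take c) → inj₁ c ; (skip c) → inj₂ c })
                  (λ { (inj₁ c) → take c ; (inj₂ c) → skip c })
                  (λ { (inj₁ _) → refl ; (inj₂ _) → refl })
                  (λ { (take _) → refl ; (skip _) → refl }))
           (⊎↔Fin (Choose↔Fin n p) (Choose↔Fin n (suc p))))

Choose⇒≤ : ∀ {n p} → Choose n p → p ≤ n
Choose⇒≤ []       = z≤n
Choose⇒≤ (skip c) = m≤n⇒m≤1+n (Choose⇒≤ c)
Choose⇒≤ (take c) = s≤s (Choose⇒≤ c)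

-- Tilings by number of nonblank tiles and of pairs

pairs : ∀ {m n} → Tiling m n → ℕ
pairs ε            = 0
pairs (blank t)    = pairs t
pairs (letter i t) = pairs t
pairs (pair t)     = suc (pairs t)

pairs≤size : ∀ {m n} (t : Tiling m n) → pairs t ≤ size t
pairs≤size ε            = z≤n
pairs≤size (blank t)    = pairs≤size t
pairs≤size (letter i t) = m≤n⇒m≤1+n (pairs≤size t)
pairs≤size (pair t)     = s≤s (pairs≤size t)

size≤length : ∀ {m n} (t : Tiling m n) → size t ≤ n
size≤length ε            = z≤n
size≤length (blank t)    = m≤n⇒m≤1+n (size≤length t)
size≤length (letter i t) = s≤s (size≤length t)
size≤length (pair t)     = s≤s (m≤n⇒m≤1+n (size≤length t))

module _ (m : ℕ) where

  TilingOf : ℕ → ℕ → ℕ → Set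
  TilingOf n d j = Σ (Tiling m n) λ t → size t ≡ d × pairs t ≡ j

  -- Shrinking each of the `j` pairs to one cell leaves `n ∸ j` tiles in a row: choose which `d` of
  -- them are nonblank, which `j` of those are pairs, and a letter for each of the other `d ∸ j`.
  tilings : ℕ → ℕ → ℕ → ℕ
  tilings n d j = (d C j) * ((n ∸ j) C d) * m ^ (d ∸ j)

  tilings-no-pairs : ∀ n d → tilings n (suc d) 0 + m * tilings n d 0 ≡ tilings (suc n) (suc d) 0
  tilings-no-pairs n d
    rewrite nC0≡1 d | nC0≡1 (suc d) | sym (nCk+nC[k+1]≡[n+1]C[k+1] n d) =
    solve 4 (λ x y m e → con 1 :* y :* (m :* e) :+ m :* (con 1 :* x :* e)
                       := con 1 :* (x :+ y) :* (m :* e))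
      refl (n C d) (n C suc d) m (m ^ d)
    where open +-*-Solver

  -- The exponent `d ∸ j` is the successor of `d ∸ suc j` only for `j < d`; otherwise the
  -- subtraction is truncated, but the binomial coefficient vanishes.
  letters-absorb : ∀ d j x → m * ((d C suc j) * x * m ^ (d ∸ suc j)) ≡ (d C suc j) * x * m ^ (d ∸ j)
  letters-absorb d j x with j <? d
  ... | yes j<d rewrite +-∸-assoc 1 j<d =
    solve 4 (λ m c x e → m :* (c :* x :* e) := c :* x :* (m :* e)) refl m (d C suc j) x (m ^ (d ∸ suc j))
    where open +-*-Solver
  ... | no  j≮d rewrite k>n⇒nCk≡0 (s≤s (≮⇒≥ j≮d)) = *-zeroʳ m

  -- For j > n both differences are truncated to 0, but the first factor vanishes unless d ≥ j > 0,
  -- and then both second factors vanish.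
  pascal-truncated : ∀ n d j → (suc d C suc j) * ((n ∸ j) C d + (n ∸ j) C suc d)
                             ≡ (suc d C suc j) * ((suc n ∸ j) C suc d)
  pascal-truncated n d j with j ≤? n
  ... | yes j≤n rewrite +-∸-assoc 1 j≤n = cong ((suc d C suc j) *_) (nCk+nC[k+1]≡[n+1]C[k+1] (n ∸ j) d)
  ... | no  j≰n rewrite m≤n⇒m∸n≡0 (<⇒≤ (≰⇒> j≰n)) | m≤n⇒m∸n≡0 (≰⇒> j≰n)
    with j ≤? d
  ...   | yes j≤d rewrite k>n⇒nCk≡0 (≤-trans (s≤s z≤n) (≤-trans (≰⇒> j≰n) j≤d)) = refl
  ...   | no  j≰d rewrite k>n⇒nCk≡0 (s≤s (≰⇒> j≰d)) = refl

  -- The summands correspond to a first tile that is blank, a letter or a pair. The last two combine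
  -- by Pascal's rule for which nonblank tiles are pairs, and the result combines with the first by
  -- Pascal's rule for which tiles are nonblank.
  tilings-rec : ∀ n d j →
    tilings (suc n) (suc d) (suc j) + (m * tilings (suc n) d (suc j) + tilings n d j)
    ≡ tilings (suc (suc n)) (suc d) (suc j)
  tilings-rec n d j = begin
    (c * y * e + (m * ((d C suc j) * x * m ^ (d ∸ suc j)) + (d C j) * x * e))
      ≡⟨ cong (λ z → c * y * e + (z + (d C j) * x * e)) (letters-absorb d j x) ⟩
    c * y * e + ((d C suc j) * x * e + (d C j) * x * e)
      ≡⟨ solve 6 (λ c y e x c₁ c₀ → c :* y :* e :+ (c₁ :* x :* e :+ c₀ :* x :* e)
                                 := (c :* y :+ (c₀ :+ c₁) :* x) :* e)
           refl c y e x (d C suc j) (d C j) ⟩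
    (c * y + (d C j + d C suc j) * x) * e
      ≡⟨ cong (λ z → (c * y + z * x) * e) (nCk+nC[k+1]≡[n+1]C[k+1] d j) ⟩
    (c * y + c * x) * e
      ≡⟨ cong (_* e) (solve 3 (λ c y x → c :* y :+ c :* x := c :* (x :+ y)) refl c y x) ⟩
    c * (x + y) * e
      ≡⟨ cong (_* e) (pascal-truncated n d j) ⟩
    tilings (suc (suc n)) (suc d) (suc j) ∎
    where
    open ≡-Reasoning
    open +-*-Solver
    c = suc d C suc j
    x = (n ∸ j) C d
    y = (n ∸ j) C suc d
    e = m ^ (d ∸ j)

  -- The recursion removes the first tile. The case `j = 0` admits no pair and needs only length
  -- one, whereas for positive `j` the recursion starts from length two; shorter rows and `d = 0`
  -- are treated directly.
  TilingOf↔Fin : ∀ n d j → TilingOf n d j ↔ Fin (tilings n d j)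
  TilingOf↔Fin n zero (suc j) =
    Fin-≡ (cong (λ c → c * ((n ∸ suc j) C 0) * 1) (sym (k>n⇒nCk≡0 {0} {suc j} (s≤s z≤n))))
      (¬⇒↔Fin0 λ (t , size≡ , pairs≡) → contradiction (subst₂ _≤_ pairs≡ size≡ (pairs≤size t)) λ ())
  TilingOf↔Fin zero zero zero = mk↔ₛ′ (λ _ → zero) (λ _ → ε , refl , refl)
    (λ { zero → refl }) (λ { (ε , refl , refl) → refl })
  TilingOf↔Fin zero (suc d) j = Fin-≡ zero-count (¬⇒↔Fin0 λ { (ε , () , _) })
    where
    zero-count : 0 ≡ tilings 0 (suc d) j
    zero-count rewrite 0∸n≡0 j | k>n⇒nCk≡0 {0} {suc d} (s≤s z≤n) | *-zeroʳ (suc d C j) = refl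
  TilingOf↔Fin (suc n) zero zero =
    Fin-≡ (cong (λ c → (0 C 0) * c * 1) (trans (nC0≡1 n) (sym (nC0≡1 (suc n)))))
      (↔-trans unblank (TilingOf↔Fin n 0 0))
    where
    unblank : TilingOf (suc n) 0 0 ↔ TilingOf n 0 0
    unblank = mk↔ₛ′ (λ { (blank t , eqs) → t , eqs ; (letter _ _ , () , _) ; (pair _ , () , _) })
                    (λ (t , eqs) → blank t , eqs)
                    (λ _ → refl)
                    (λ { (blank _ , _) → refl ; (letter _ _ , () , _) ; (pair _ , () , _) })
  TilingOf↔Fin (suc n) (suc d) zero = Fin-≡ (tilings-no-pairs n d)
    (↔-trans split (⊎↔Fin (TilingOf↔Fin n (suc d) 0) (×↔Fin ↔-refl (TilingOf↔Fin n d 0))))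
    where
    split : TilingOf (suc n) (suc d) 0 ↔ (TilingOf n (suc d) 0 ⊎ (Fin m × TilingOf n d 0))
    split = mk↔ₛ′ (λ { (blank t , eqs) → inj₁ (t , eqs)
                     ; (letter i t , refl , eq) → inj₂ (i , t , refl , eq)
                     ; (pair _ , _ , ()) })
                  (λ { (inj₁ (t , eqs)) → blank t , eqs
                     ; (inj₂ (i , t , refl , eq)) → letter i t , refl , eq })
                  (λ { (inj₁ _) → refl ; (inj₂ (_ , _ , refl , _)) → refl })
                  (λ { (blank _ , _) → refl ; (letter _ _ , refl , _) → refl ; (pair _ , _ , ()) })
  -- A single cell has no room for a pair; in the formula `1 ∸ suc j` is `0`, so no `suc d` tiles
  -- can be chosen.
  TilingOf↔Fin (suc zero) (suc d) (suc j) = Fin-≡ zero-count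
    (¬⇒↔Fin0 λ { (blank ε , () , _) ; (letter i ε , _ , ()) })
    where
    zero-count : 0 ≡ tilings 1 (suc d) (suc j)
    zero-count rewrite 0∸n≡0 j | k>n⇒nCk≡0 {0} {suc d} (s≤s z≤n) | *-zeroʳ (suc d C suc j) = refl
  TilingOf↔Fin (suc (suc n)) (suc d) (suc j) = Fin-≡ (tilings-rec n d j)
    (↔-trans split (⊎↔Fin (TilingOf↔Fin (suc n) (suc d) (suc j))
      (⊎↔Fin (×↔Fin ↔-refl (TilingOf↔Fin (suc n) d (suc j))) (TilingOf↔Fin n d j))))
    where
    split : TilingOf (suc (suc n)) (suc d) (suc j) ↔
            (TilingOf (suc n) (suc d) (suc j) ⊎ (Fin m × TilingOf (suc n) d (suc j)) ⊎ TilingOf n d j)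
    split = mk↔ₛ′ (λ { (blank t , eqs) → inj₁ (t , eqs)
                     ; (letter i t , refl , eq) → inj₂ (inj₁ (i , t , refl , eq))
                     ; (pair t , refl , refl) → inj₂ (inj₂ (t , refl , refl)) })
                  (λ { (inj₁ (t , eqs)) → blank t , eqs
                     ; (inj₂ (inj₁ (i , t , refl , eq))) → letter i t , refl , eq
                     ; (inj₂ (inj₂ (t , refl , refl))) → pair t , refl , refl })
                  (λ { (inj₁ _) → refl ; (inj₂ (inj₁ (_ , _ , refl , _))) → refl
                     ; (inj₂ (inj₂ (_ , refl , refl))) → refl })
                  (λ { (blank _ , _) → refl ; (letter _ _ , refl , _) → refl
                     ; (pair _ , refl , refl) → refl })

  Code↔∃ : ∀ {n p} → Code m n p ↔ (∃ λ d → ∃ λ j → Choose d p × TilingOf n d j)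
  Code↔∃ {n} {p} = mk↔ₛ′ to from (λ { (_ , _ , _ , _ , refl , refl) → refl }) (λ _ → refl)
    where
    to : Code m n p → ∃ λ d → ∃ λ j → Choose d p × TilingOf n d j
    to (t , c) = size t , pairs t , c , t , refl , refl
    from : (∃ λ d → ∃ λ j → Choose d p × TilingOf n d j) → Code m n p
    from (_ , _ , c , t , refl , refl) = t , c

  Code↔Fin : ∀ n p → Code m n p ↔
    Fin (∑[ d from p to n ] (∑[ j from 0 to d ] ((d C p) * (d C j) * ((n ∸ j) C d) * m ^ (d ∸ j))))
  Code↔Fin n p = ↔-trans Code↔∃ (∃↔Fin-sumFromTo p n
    (λ d → ∃↔Fin-sumFromTo 0 d
      (λ j → Fin-≡ (regroup (d C p) (d C j) ((n ∸ j) C d) (m ^ (d ∸ j)))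
                   (×↔Fin (Choose↔Fin d p) (TilingOf↔Fin n d j)))
      (λ { _ (_ , t , refl , refl) → z≤n , pairs≤size t }))
    (λ { _ (_ , c , t , refl , refl) → Choose⇒≤ c , size≤length t }))
    where
    open +-*-Solver
    regroup : ∀ a b c e → a * (b * c * e) ≡ a * b * c * e
    regroup = solve 4 (λ a b c e → a :* (b :* c :* e) := a :* b :* c :* e) refl

corollary4p6 : (k n p : ℕ) → .{{_ : NonZero k}} → p ≤ n →
    HasCardinality (InducedCopies (Hypercube p) (Munarini n k))
    (∑[ d from p to n ] (∑[ j from 0 to d ] ((d C p) * (d C j) * ((n ∸ j) C d) * (k ∸ 1) ^ (d ∸ j))))
corollary4p6 zero    n p {{k≢0}} _ = contradiction-irr refl (≢-nonZero⁻¹ 0 {{k≢0}})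
corollary4p6 (suc m) n p         _ =
  Composition.inverse (Symmetry.inverse (codes↔copies p)) (Code↔Fin m n p)
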